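{- An undirected graph $H$ is $\alpha$-acyclic if and only if $H$ contains no induced copy of the cycle $C_k$ for every $k\geq 6$.
   Context: A hypergraph $F$ is $\alpha$-acyclic if there is a tree $T$ whose vertices are the hyperedges of $F$ such that for all hyperedges $e_1,e_2,e$, if $e$ lies on the unique path in $T$ between $e_1$ and $e_2$ then $e_1\cap e_2\subseteq e$. For a directed acyclic graph $\vec H$ and a vertex $u$, $R(u)$ denotes the set of vertices reachable from $u$ by a directed path (so $u\in R(u)$). If $u_1,\dots,u_r$ are the sources of $\vec H$, the associated hypergraph has vertex set $V(\vec H)$ and hyperedges $R(u_1),\dots,R(u_r)$; $\vec H$ is $\alpha$-acyclic if this hypergraph is $\alpha$-acyclic. An undirected graph $H$ is $\alpha$-acyclic if every acyclic orientation of $H$ is $\alpha$-acyclic. $C_k$ denotes the cycle of length $k$. -}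

module Defs where

open import Level using (0ℓ)
open import Data.Nat using (ℕ; zero; suc)
open import Data.Bool using (Bool; true; false; T; _∨_)
open import Data.Fin using (Fin; toℕ)
open import Data.Fin.Properties using (all?)
open import Data.List using (List; []; _∷_)
open import Data.List.Membership.Propositional using (_∈_)
open import Data.List.Relation.Unary.Unique.Propositional using (Unique)
open import Data.Product using (Σ; ∃; _×_; _,_)
open import Data.Sum using (_⊎_)
open import Data.Empty using (⊥)
open import Relation.Nullary using (¬_)
open import Relation.Nullary.Decidable using (True)
open import Relation.Binary.PropositionalEquality using (_≡_; _≢_)
open import Relation.Binary.Construct.Closure.ReflexiveTransitive using (Star)
open import Function.Definitions using (Injective)
open import Function.Bundles using (_⇔_)

record Graph (n : ℕ) : Set where
  field
    adj   : Fin n → Fin n → Bool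
    sym   : ∀ u v → adj u v ≡ adj v u
    irref : ∀ u → adj u u ≡ false
open Graph public

data Walk {I : Set} (Tr : I → I → Set) : I → I → List I → Set where
  single : ∀ a → Walk Tr a a (a ∷ [])
  step   : ∀ {a b c vs} → Tr a b → Walk Tr b c vs → Walk Tr a c (a ∷ vs)

Path : {I : Set} (Tr : I → I → Set) → I → I → List I → Set
Path Tr a b vs = Walk Tr a b vs × Unique vs

IsTree : {I : Set} → (I → I → Set) → Set
IsTree {I} Tr =
    (∀ a b → Tr a b → Tr b a)
  × (∀ a b → ∃ λ vs → Path Tr a b vs)
  × (∀ a b vs ws → Path Tr a b vs → Path Tr a b ws → vs ≡ ws)

αAcyclicHyp : {I V : Set} → (I → V → Set) → Set₁
αAcyclicHyp {I} {V} E =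
  Σ (I → I → Set) λ Tr →
    IsTree Tr
    × (∀ e₁ e₂ vs → Path Tr e₁ e₂ vs → ∀ e → e ∈ vs →
         ∀ x → E e₁ x → E e₂ x → E e x)

-- o u v = true means the arc u → v.  Every edge gets exactly one direction,
-- non-edges get none.
IsOrientation : ∀ {n} → Graph n → (Fin n → Fin n → Bool) → Set
IsOrientation H o =
    (∀ u v → adj H u v ≡ (o u v ∨ o v u))
  × (∀ u v → o u v ≡ true → o v u ≡ false)

Arc : ∀ {n} → (Fin n → Fin n → Bool) → Fin n → Fin n → Set
Arc o u v = T (o u v)

Reach : ∀ {n} → (Fin n → Fin n → Bool) → Fin n → Fin n → Set
Reach o = Star (Arc o)

IsAcyclicDir : ∀ {n} → (Fin n → Fin n → Bool) → Set
IsAcyclicDir o = ∀ u v → Arc o u v → ¬ Reach o v u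

IsSource : ∀ {n} → (Fin n → Fin n → Bool) → Fin n → Set
IsSource o u = ∀ w → o w u ≡ false

isSource? : ∀ {n} (o : Fin n → Fin n → Bool) (u : Fin n) →
            Relation.Nullary.Dec (IsSource o u)
isSource? o u = all? λ w → Data.Bool._≟_ (o w u) false
  where import Data.Bool

Source : ∀ {n} → (Fin n → Fin n → Bool) → Set
Source {n} o = Σ (Fin n) λ u → True (isSource? o u)

αAcyclicDir : ∀ {n} → (Fin n → Fin n → Bool) → Set₁
αAcyclicDir o = αAcyclicHyp {Source o} (λ s x → Reach o (Data.Product.proj₁ s) x)
  where import Data.Product

αAcyclicGraph : ∀ {n} → Graph n → Set₁
αAcyclicGraph {n} H =
  ∀ (o : Fin n → Fin n → Bool) → IsOrientation H o → IsAcyclicDir o → αAcyclicDir o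

CycAdj : (k : ℕ) → Fin k → Fin k → Set
CycAdj k i j =
    (suc (toℕ i) ≡ toℕ j) ⊎ (suc (toℕ j) ≡ toℕ i)
  ⊎ (suc (toℕ i) ≡ k × toℕ j ≡ 0) ⊎ (suc (toℕ j) ≡ k × toℕ i ≡ 0)

HasInducedCycle : ∀ {n} → Graph n → ℕ → Set
HasInducedCycle {n} H k =
  Σ (Fin k → Fin n) λ f →
    Injective _≡_ _≡_ f × (∀ i j → T (adj H (f i) (f j)) ⇔ CycAdj k i j)

{-# OPTIONS --safe #-}

-- If H has an induced cycle of length at least 6, orient it with three sources on the cycle,
-- alternating with three sinks of the cycle, and let all other vertices come later.  Each of these
-- sinks lies below exactly two sources of the orientation, so any join tree must contain a triangle.
--
-- Conversely, to build a join tree of a family S of hyperedges rooted at e ∉ S, pick f ∈ S with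
-- |e ∩ f| maximal and let C be the class of f under "sharing a vertex outside e".  If e ∩ g ⊆ e ∩ f
-- for all g in C, hang a join tree of C rooted at f below e, next to one of S ∖ C rooted at e.
-- Otherwise there are u, v ∈ e and a chain of hyperedges leading from u to v outside e, no member of
-- which contains both u and v.  Replace e by a lowest vertex a above both u and v; then a together
-- with a shortest path from a child of a above u to one above v, through vertices that are not above
-- both, is an induced cycle of length at least 6.

module Submission where

open import Defs
open import Data.Nat using (ℕ; _≤_)
open import Relation.Nullary using (¬_)
open import Function.Bundles using (_⇔_)

open import Data.Bool using (Bool; true; false; T; _∨_; _∧_)
open import Data.Bool.Properties using (T-≡; T-∧; T-∨; T-irrelevant; ¬-not)
open import Data.Empty using (⊥; ⊥-elim)
open import Data.Fin using (Fin; zero; suc; toℕ; fromℕ<)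
import Data.Fin.Properties as Fin
open import Data.List
  using (List; []; _∷_; _++_; [_]; _∷ʳ_; length; filter; reverse; allFin; lookup; concatMap;
         deduplicate)
open import Data.List.Extrema.Nat using (argmax; argmax-sel; f[⊥]≤f[argmax]; f[xs]≤f[argmax])
open import Data.List.Membership.Propositional using (_∈_; _∉_; find)
open import Data.List.Membership.Propositional.Properties
  using (∈-∃++; ∈-allFin; ∈-lookup; ∈-++⁻; ∈-++⁺ˡ; ∈-++⁺ʳ; ∈-concatMap⁺; ∈-deduplicate⁺)
open import Data.List.Properties using (reverse-injective; unfold-reverse; length-++)
open import Data.List.Relation.Binary.Disjoint.Propositional using (Disjoint)
open import Data.List.Relation.Binary.Permutation.Propositional
  using (_↭_; prep; ↭-refl; ↭-reflexive; ↭-sym; ↭-trans; ↭⇒↭ₛ)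
open import Data.List.Relation.Binary.Permutation.Propositional.Properties
  using (∈-resp-↭; shift; ↭-reverse; ↭-length; ++⁺ˡ)
import Data.List.Relation.Binary.Permutation.Setoid.Properties as PermutationSetoid
open import Data.List.Relation.Binary.Subset.Propositional using (_⊆_)
open import Data.List.Relation.Binary.Subset.Propositional.Properties using (∷⁺ʳ)
open import Data.List.Relation.Unary.All as All using (All; []; _∷_)
import Data.List.Relation.Unary.All.Properties as All
open import Data.List.Relation.Unary.AllPairs as AllPairs using ([]; _∷_)
open import Data.List.Relation.Unary.Any as Any using (Any; here; there)
import Data.List.Relation.Unary.Unique.DecPropositional.Properties as Unique
open import Data.List.Relation.Unary.Unique.Propositional using (Unique)
open import Data.List.Relation.Unary.Unique.Propositional.Properties using (Unique[x∷xs]⇒x∉xs)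
open import Data.Nat using (zero; suc; _+_; _*_; _∸_; _<_; _<ᵇ_; z≤n; s≤s)
import Data.Nat.Properties as ℕ
open import Data.Product using (∃; ∃₂; _×_; _,_; proj₁; proj₂)
open import Data.Sum as Sum using (_⊎_; inj₁; inj₂; [_,_]′)
open import Function using (_∘_; id; case_of_)
open import Function.Bundles using (mk⇔; Equivalence)
open import Function.Definitions using (Injective)
open import Relation.Binary.Construct.Closure.ReflexiveTransitive as Star using (Star; ε; _◅_; _◅◅_)
open import Relation.Binary.Definitions using (DecidableEquality; Symmetric; tri<; tri≈; tri>)
import Relation.Binary.Definitions as B
open import Relation.Binary.PropositionalEquality as ≡ using (_≡_; _≢_; refl; cong; subst; setoid)
open import Relation.Nullary using (Dec; yes; no; contradiction)
open import Relation.Nullary.Decidable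
  using (_×-dec_; _⊎-dec_; ¬?; T?; ⌊_⌋; toWitness; fromWitness; decidable-stable)
import Relation.Unary as U

private variable
  I : Set
  n : ℕ

-- Lists without repetition

Unique-resp-↭ : {xs ys : List I} → xs ↭ ys → Unique xs → Unique ys
Unique-resp-↭ p = PermutationSetoid.Unique-resp-↭ (setoid _) (↭⇒↭ₛ p)

Unique-++⁻ : ∀ (xs : List I) {ys} → Unique (xs ++ ys) → Unique xs × Unique ys × Disjoint xs ys
Unique-++⁻ []       u        = [] , u , λ ()
Unique-++⁻ (x ∷ xs) (x≢ ∷ u) with Unique-++⁻ xs u
... | uxs , uys , dis = All.++⁻ˡ xs x≢ ∷ uxs , uys , λ
  { (here refl , y∈) → All.lookup (All.++⁻ʳ xs x≢) y∈ refl
  ; (there y∈ , y∈′) → dis (y∈ , y∈′) }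

-- Counting and search in finite sets

∣_∣ : {P : Fin n → Set} → U.Decidable P → ℕ
∣ P? ∣ = length (filter P? (allFin _))

module _ {A : Set} {P Q : A → Set} (P? : U.Decidable P) (Q? : U.Decidable Q)
         (P⊆Q : ∀ {x} → P x → Q x) where

  length-filter-≤ : ∀ xs → length (filter P? xs) ≤ length (filter Q? xs)
  length-filter-≤ [] = z≤n
  length-filter-≤ (x ∷ xs) with P? x | Q? x
  ... | yes p | yes q = s≤s (length-filter-≤ xs)
  ... | yes p | no ¬q = contradiction (P⊆Q p) ¬q
  ... | no ¬p | yes q = ℕ.m≤n⇒m≤1+n (length-filter-≤ xs)
  ... | no ¬p | no ¬q = length-filter-≤ xs

  length-filter-< : ∀ {x xs} → x ∈ xs → Q x → ¬ P x → length (filter P? xs) < length (filter Q? xs)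
  length-filter-< {x} {_ ∷ xs} (here refl) q ¬p with P? x | Q? x
  ... | yes p | _     = contradiction p ¬p
  ... | no _  | yes _ = s≤s (length-filter-≤ xs)
  ... | no _  | no ¬q = contradiction q ¬q
  length-filter-< {x} {y ∷ _} (there x∈) q ¬p with P? y | Q? y
  ... | yes _ | yes _ = s≤s (length-filter-< x∈ q ¬p)
  ... | yes p | no ¬q = contradiction (P⊆Q p) ¬q
  ... | no _  | yes _ = ℕ.m≤n⇒m≤1+n (length-filter-< x∈ q ¬p)
  ... | no _  | no _  = length-filter-< x∈ q ¬p

∣∣-strict : {P Q : Fin n → Set} (P? : U.Decidable P) (Q? : U.Decidable Q) → (∀ {x} → P x → Q x) →
            ∀ x → Q x → ¬ P x → ∣ P? ∣ < ∣ Q? ∣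
∣∣-strict P? Q? P⊆Q x = length-filter-< P? Q? P⊆Q (∈-allFin x)

⊆-or-witness : {P Q : Fin n → Set} → U.Decidable P → U.Decidable Q →
               (∀ x → P x → Q x) ⊎ ∃ λ x → P x × ¬ Q x
⊆-or-witness P? Q? with Fin.any? (λ x → P? x ×-dec ¬? (Q? x))
... | yes w = inj₂ w
... | no ¬w = inj₁ λ x p → decidable-stable (Q? x) λ ¬q → ¬w (x , p , ¬q)

-- `Q` is the invariant carried along while the class of `f` grows: reachability in `star?`, a chain
-- of covered hyperedges in `joinTree`.
record Saturation {I : Set} (L : I → I → Set) (Q : I → Set) (f : I) (D : List I) : Set where
  field
    inner outer : List I
    partition   : inner ++ outer ↭ D
    sound       : All Q (f ∷ inner)
    closed      : ∀ {c d} → c ∈ f ∷ inner → d ∈ outer → ¬ L c d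

module _ {I : Set} {L : I → I → Set} (L? : B.Decidable L) where

  saturate : {Q : I → Set} {f : I} (D : List I) → Q f →
             (∀ {c d} → Q c → d ∈ D → L c d → Q d) → Saturation L Q f D
  saturate {Q} {f} D₀ Qf extend = grow (length D₀) [] D₀ ℕ.≤-refl ↭-refl (Qf ∷ [])
    where
    grow : ∀ m C D → length D ≤ m → C ++ D ↭ D₀ → All Q (f ∷ C) → Saturation L Q f D₀
    grow m C D D≤m p Qs with Any.any? (λ d → Any.any? (λ c → L? c d) (f ∷ C)) D
    ... | no ¬link = record
      { partition = p ; sound = Qs
      ; closed = λ c∈ d∈ l → ¬link (Any.map (λ { refl → Any.map (λ { refl → l }) c∈ }) d∈) }
    ... | yes link with find link
    ...   | d , d∈D , l with ∈-∃++ d∈D | find l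
    ...     | as , bs , refl | c , c∈ , Lcd = grow′ m D≤m
      where
      shorter : length D ≡ suc (length (as ++ bs))
      shorter = ↭-length (shift d as bs)

      grow′ : ∀ m → length D ≤ m → Saturation L Q f D₀
      grow′ zero    D≤0 = contradiction (ℕ.≤-trans (ℕ.≤-reflexive (≡.sym shorter)) D≤0) λ ()
      grow′ (suc m) D≤m = grow m (d ∷ C) (as ++ bs)
        (ℕ.≤-pred (ℕ.≤-trans (ℕ.≤-reflexive (≡.sym shorter)) D≤m))
        (↭-trans (↭-sym (shift d C (as ++ bs))) (↭-trans (++⁺ˡ C (↭-sym (shift d as bs))) p))
        (All.head Qs ∷ extend (All.lookup Qs c∈) (∈-resp-↭ p (∈-++⁺ʳ C d∈D)) Lcd ∷ All.tail Qs)

module _ {L : Fin n → Fin n → Set} (L? : B.Decidable L) where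

  -- No walk from `u` leaves its saturated set, so reachability becomes list membership.
  star? : B.Decidable (Star L)
  star? u v = decide (Any.any? (v Fin.≟_) (u ∷ inner))
    where
    open Saturation (saturate L? {Q = Star L u} {f = u} (allFin n) ε (λ s _ l → s ◅◅ l ◅ ε))

    stays : ∀ {x y} → Star L x y → x ∈ u ∷ inner → y ∈ u ∷ inner
    stays ε x∈ = x∈
    stays (_◅_ {j = z} l s) x∈ with ∈-++⁻ inner (∈-resp-↭ (↭-sym partition) (∈-allFin z))
    ... | inj₁ z∈ = stays s (there z∈)
    ... | inj₂ z∈ = contradiction l (closed x∈ z∈)

    decide : Dec (v ∈ u ∷ inner) → Dec (Star L u v)
    decide (yes v∈) = yes (All.lookup sound v∈)
    decide (no v∉)  = no λ s → v∉ (stays s (here refl))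

-- Join trees

module _ {I V : Set} (E : I → V → Set) where

  -- A join tree rooted at r, listed so that every node precedes its parent.
  data Join (r : I) : List I → Set where
    root   : Join r (r ∷ [])
    attach : ∀ {s h ys} → Join r ys → s ∉ ys → h ∈ ys →
             (∀ {g x} → g ∈ ys → E s x → E g x → E h x) → Join r (s ∷ ys)

  root∈ : ∀ {r ys} → Join r ys → r ∈ ys
  root∈ root             = here refl
  root∈ (attach j _ _ _) = there (root∈ j)

  -- The nodes of `ys` are attached to the second tree one by one, parents first, with the root `f`
  -- identified with its copy in `zs`. A vertex shared with a member of `zs` lies in `f` by `sep`,
  -- so the ear condition inside `ys` already applies to it.
  glue : ∀ {f r ys zs} → Join f ys → Join r zs → f ∈ zs →
         (∀ {y} → y ∈ ys → y ∈ zs → y ≡ f) →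
         (∀ {y z x} → y ∈ ys → z ∈ zs → E y x → E z x → E f x) →
         ∃ λ ws → Join r ws × ws ⊆ ys ++ zs × ys ++ zs ⊆ ws
  glue root k f∈zs _ _ = _ , k , there , λ { (here refl) → f∈zs ; (there x∈) → x∈ }
  glue {f} {zs = zs} (attach {s} {h} {ys} j s∉ys h∈ys ear) k f∈zs meet sep
    with glue j k f∈zs (meet ∘ there) (sep ∘ there)
  ... | ws , l , to , from =
    s ∷ ws , attach l s∉ws (from (∈-++⁺ˡ h∈ys)) ear′ , ∷⁺ʳ s to , ∷⁺ʳ s from
    where
    s∉zs : s ∉ zs
    s∉zs s∈ = s∉ys (subst (_∈ ys) (≡.sym (meet (here refl) s∈)) (root∈ j))

    s∉ws : s ∉ ws
    s∉ws s∈ = [ s∉ys , s∉zs ]′ (∈-++⁻ ys (to s∈))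

    ear′ : ∀ {g x} → g ∈ ws → E s x → E g x → E h x
    ear′ g∈ Es Eg with ∈-++⁻ ys (to g∈)
    ... | inj₁ g∈ys = ear g∈ys Es Eg
    ... | inj₂ g∈zs = ear (root∈ j) Es (sep (here refl) g∈zs Es Eg)

  Avoid : V → V → I → Set
  Avoid u v g = ¬ (E g u × E g v)

  Linked : I → I → I → Set
  Linked e f g = ∃ λ x → E f x × E g x × ¬ E e x

  -- The only obstruction to acyclicity: u and v lie in e, and a chain of hyperedges outside e
  -- leads from u to v without any single member containing both.
  Unobstructed : Set
  Unobstructed = ∀ {e u v f g} → E e u → E e v → E f u → E g v → Avoid u v f →
                 ¬ Star (λ p q → Linked e p q × Avoid u v q) f g

module JoinTree {I : Set} {n : ℕ} {E : I → Fin n → Set} (E? : B.Decidable E)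
                (unobstructed : Unobstructed E) where

  linked? : ∀ e → B.Decidable (Linked E e)
  linked? e f g = Fin.any? λ x → E? f x ×-dec E? g x ×-dec ¬? (E? e x)

  unlinked : ∀ {e f g x} → ¬ Linked E e f g → E f x → E g x → E e x
  unlinked {e} {x = x} ¬l Ef Eg = decidable-stable (E? e x) λ ¬Ee → ¬l (x , Ef , Eg , ¬Ee)

  _∩?_ : ∀ e f → U.Decidable (λ x → E e x × E f x)
  (e ∩? f) x = E? e x ×-dec E? f x

  Covered : I → I → I → Set
  Covered e f g = ∀ x → E e x × E g x → E e x × E f x

  -- The tree dictates the order of `ws`, so only its set of members is fixed.
  JoinOn : I → List I → Set
  JoinOn e S = ∃ λ ws → Join E e ws × ws ⊆ e ∷ S × e ∷ S ⊆ ws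

  -- f becomes a child of e, and the join tree of f ∷ C is hung below f.
  assemble : ∀ {e f C D} → Unique (e ∷ f ∷ C ++ D) → All (Covered e f) (f ∷ C) →
             (∀ {c d} → c ∈ f ∷ C → d ∈ D → ¬ Linked E e c d) →
             JoinOn f C → JoinOn e D → JoinOn e (f ∷ C ++ D)
  assemble {e} {f} {C} {D} uniq covered closed (ys , jf , ys⊆ , ⊆ys) (zs , je , zs⊆ , ⊆zs) =
    finish (glue E jf (attach je f∉zs (root∈ E je) f-ear) (here refl) meet sep)
    where
    e∉fCD : e ∉ f ∷ C ++ D
    e∉fCD = Unique[x∷xs]⇒x∉xs uniq

    disjoint : Disjoint (f ∷ C) D
    disjoint = proj₂ (proj₂ (Unique-++⁻ (f ∷ C) (AllPairs.tail uniq)))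

    f∉zs : f ∉ zs
    f∉zs f∈ with zs⊆ f∈
    ... | here refl = e∉fCD (here refl)
    ... | there f∈D = disjoint (here refl , f∈D)

    f-ear : ∀ {g x} → g ∈ zs → E f x → E g x → E e x
    f-ear g∈ Ef Eg with zs⊆ g∈
    ... | here refl = Eg
    ... | there g∈D = unlinked (closed (here refl) g∈D) Ef Eg

    meet : ∀ {y} → y ∈ ys → y ∈ f ∷ zs → y ≡ f
    meet y∈ (here y≡f)  = y≡f
    meet y∈ (there y∈zs) with zs⊆ y∈zs
    ... | here refl = contradiction (∈-++⁺ˡ (ys⊆ y∈)) e∉fCD
    ... | there y∈D = ⊥-elim (disjoint (ys⊆ y∈ , y∈D))

    sep : ∀ {y z x} → y ∈ ys → z ∈ f ∷ zs → E y x → E z x → E f x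
    sep y∈ (here refl) Ey Ez = Ez
    sep {y} {z} {x} y∈ (there z∈) Ey Ez =
      -- The shared vertex lies in `e`, either because `z` is `e` or because no link outside `e`
      -- joins `f ∷ C` to `D`; coverage then puts it into `f`.
      proj₂ (All.lookup covered (ys⊆ y∈) x (Ee (zs⊆ z∈) , Ey))
      where
      Ee : z ∈ e ∷ D → E e x
      Ee (here refl) = Ez
      Ee (there z∈D) = unlinked (closed (ys⊆ y∈) z∈D) Ey Ez

    finish : (∃ λ ws → Join E e ws × ws ⊆ ys ++ f ∷ zs × ys ++ f ∷ zs ⊆ ws) →
             JoinOn e (f ∷ C ++ D)
    finish (ws , j , ws⊆ , ⊆ws) = ws , j , into , onto
      where
      into : ws ⊆ e ∷ f ∷ C ++ D
      into x∈ with ∈-++⁻ ys (ws⊆ x∈)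
      ... | inj₁ x∈ys          = there (∈-++⁺ˡ (ys⊆ x∈ys))
      ... | inj₂ (here refl)   = there (here refl)
      ... | inj₂ (there x∈zs) with zs⊆ x∈zs
      ...   | here refl = here refl
      ...   | there x∈D = there (∈-++⁺ʳ (f ∷ C) x∈D)

      onto : e ∷ f ∷ C ++ D ⊆ ws
      onto (here refl) = ⊆ws (∈-++⁺ʳ ys (there (⊆zs (here refl))))
      onto (there x∈) with ∈-++⁻ (f ∷ C) x∈
      ... | inj₁ x∈fC = ⊆ws (∈-++⁺ˡ (⊆ys x∈fC))
      ... | inj₂ x∈D  = ⊆ws (∈-++⁺ʳ ys (there (⊆zs (there x∈D))))

  -- The whole chain from `f` is kept, not just coverage of its last member, because `extend` turns
  -- it into an obstruction.
  Chain : I → I → I → I → Set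
  Chain e f = Star (λ p q → Linked E e p q × Covered e f q)

  covered : ∀ {e f p g} → Covered e f p → Chain e f p g → Covered e f g
  covered c ε             = c
  covered _ ((_ , c) ◅ s) = covered c s

  -- A member that is not covered misses some u in e ∩ f, by maximality of f.
  extend : ∀ {e f c d} → ∣ e ∩? d ∣ ≤ ∣ e ∩? f ∣ → Chain e f f c → Linked E e c d → Chain e f f d
  extend {e} {f} {c} {d} d≤f s l with ⊆-or-witness (e ∩? d) (e ∩? f)
  ... | inj₁ d-covered = s ◅◅ (l , d-covered) ◅ ε
  ... | inj₂ (v , (Eev , Edv) , ¬Efv) with ⊆-or-witness (e ∩? f) (e ∩? d)
  ...   | inj₁ f⊆d = contradiction d≤f
                       (ℕ.<⇒≱ (∣∣-strict (e ∩? f) (e ∩? d) (λ {x} → f⊆d x) v (Eev , Edv) ¬Efv))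
  ...   | inj₂ (u , (Eeu , Efu) , ¬Edu) = ⊥-elim
    -- Every member of `s` is covered, so it misses `v` as `f` does, and `d` misses `u`. The chain
    -- from `f` to `d` is thus an obstruction.
    (unobstructed Eeu Eev Efu Edv (λ { (_ , Efv) → ¬Efv (Eev , Efv) })
      (Star.map (λ { (l , c) → l , λ { (_ , Eqv) → ¬Efv (c v (Eev , Eqv)) } }) s
        ◅◅ (l , λ { (Edu , _) → ¬Edu (Eeu , Edu) }) ◅ ε))

  joinTree : ∀ m e S → length S ≤ m → Unique (e ∷ S) → JoinOn e S
  joinTree m e [] _ _ = _ , root , id , id
  joinTree (suc m) e S@(f₀ ∷ S₀) S≤m uniq = pivot (∈-∃++ f∈S)
    where
    common : I → ℕ
    common g = ∣ e ∩? g ∣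

    f : I
    f = argmax common f₀ S₀

    f∈S : f ∈ S
    f∈S = [ here , there ]′ (argmax-sel common f₀ S₀)

    f-max : ∀ {g} → g ∈ S → common g ≤ common f
    f-max (here refl) = f[⊥]≤f[argmax] {f = common} f₀ S₀
    f-max (there g∈)  = All.lookup (f[xs]≤f[argmax] {f = common} f₀ S₀) g∈

    pivot : (∃₂ λ as bs → S ≡ as ++ [ f ] ++ bs) → JoinOn e S
    pivot (as , bs , S≡) = split (saturate (linked? e) {Q = Chain e f f} (as ++ bs) ε
        (λ s d∈ → extend (f-max (∈-resp-↭ (↭-sym S↭) (there d∈))) s))
      where
      S↭ : S ↭ f ∷ as ++ bs
      S↭ = ↭-trans (↭-reflexive S≡) (shift f as bs)

      split : Saturation (Linked E e) (Chain e f f) f (as ++ bs) → JoinOn e S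
      split record { inner = C ; outer = D ; partition = CD↭ ; sound = sound ; closed = closed } =
        permuted (assemble uniq′ (All.map (covered (λ _ → id)) sound) closed
          (joinTree m f C (ℕ.≤-trans (ℕ.m≤m+n _ _) C+D≤m) (proj₁ parts))
          (joinTree m e D (ℕ.≤-trans (ℕ.m≤n+m _ _) C+D≤m)
            (All.++⁻ʳ (f ∷ C) (AllPairs.head uniq′) ∷ proj₁ (proj₂ parts))))
        where
        S↭CD : S ↭ f ∷ C ++ D
        S↭CD = ↭-trans S↭ (prep f (↭-sym CD↭))

        C+D≤m : length C + length D ≤ m
        C+D≤m = ℕ.≤-trans (ℕ.≤-reflexive (≡.sym (length-++ C)))
                  (ℕ.≤-pred (ℕ.≤-trans (ℕ.≤-reflexive (≡.sym (↭-length S↭CD))) S≤m))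

        uniq′ : Unique (e ∷ f ∷ C ++ D)
        uniq′ = Unique-resp-↭ (prep e S↭CD) uniq

        parts : Unique (f ∷ C) × Unique D × Disjoint (f ∷ C) D
        parts = Unique-++⁻ (f ∷ C) (AllPairs.tail uniq′)

        permuted : JoinOn e (f ∷ C ++ D) → JoinOn e S
        permuted (ws , j , ws⊆ , ⊆ws) =
          ws , j , ∈-resp-↭ (prep e (↭-sym S↭CD)) ∘ ws⊆ , ⊆ws ∘ ∈-resp-↭ (prep e S↭CD)

-- Paths in trees

module _ {I : Set} {Tr : I → I → Set} where

  first∈ : ∀ {a b vs} → Walk Tr a b vs → a ∈ vs
  first∈ (single _) = here refl
  first∈ (step _ _) = here refl

  last∈ : ∀ {a b vs} → Walk Tr a b vs → b ∈ vs
  last∈ (single _) = here refl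
  last∈ (step _ w) = there (last∈ w)

  walk-snoc : ∀ {a b c vs} → Walk Tr a b vs → Tr b c → Walk Tr a c (vs ∷ʳ c)
  walk-snoc (single _) t = step t (single _)
  walk-snoc (step t′ w) t = step t′ (walk-snoc w t)

  path-reverse : Symmetric Tr → ∀ {a b vs} → Path Tr a b vs → Path Tr b a (reverse vs)
  path-reverse tr-sym {vs = vs} (w , u) = go w , Unique-resp-↭ (↭-sym (↭-reverse vs)) u
    where
    go : ∀ {a b vs} → Walk Tr a b vs → Walk Tr b a (reverse vs)
    go (single a) = single a
    go (step {a} {vs = vs} t w) =
      subst (Walk Tr _ _) (≡.sym (unfold-reverse a vs)) (walk-snoc (go w) (tr-sym t))

module _ {I V : Set} (E : I → V → Set) where

  -- The relation `Tr` lives on all of `I` and is confined to `ys` by `inside` and `symmetric`, so a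
  -- leaf can be added without changing the type of nodes.
  record JoinTreeOn (ys : List I) : Set₁ where
    field
      Tr        : I → I → Set
      inside    : ∀ {a b} → Tr a b → b ∈ ys
      symmetric : Symmetric Tr
      connected : ∀ {a b} → a ∈ ys → b ∈ ys → ∃ λ vs → Path Tr a b vs
      unique    : ∀ {a b vs ws} → Path Tr a b vs → Path Tr a b ws → vs ≡ ws
      running   : ∀ {a b vs} → Path Tr a b vs → ∀ {e x} → e ∈ vs → E a x → E b x → E e x

  -- Paths between old nodes never visit `s`, and a nontrivial path from `s` continues at `h`.
  -- Uniqueness and running intersection thus reduce to the old tree; paths ending in `s` are
  -- reversed first.
  addLeaf : DecidableEquality I → ∀ {s h ys} → s ∉ ys → h ∈ ys →
            (∀ {g x} → g ∈ ys → E s x → E g x → E h x) → JoinTreeOn ys → JoinTreeOn (s ∷ ys)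
  addLeaf _≟_ {s} {h} {ys} s∉ys h∈ys ear T = record
    { Tr = Tr′ ; inside = inside′ ; symmetric = sym′
    ; connected = connected′ ; unique = unique′ ; running = running′ }
    where
    open JoinTreeOn T

    data Tr′ : I → I → Set where
      old  : ∀ {a b} → Tr a b → Tr′ a b
      down : Tr′ h s
      up   : Tr′ s h

    inside′ : ∀ {a b} → Tr′ a b → b ∈ s ∷ ys
    inside′ (old t) = there (inside t)
    inside′ down    = here refl
    inside′ up      = there h∈ys

    sym′ : Symmetric Tr′
    sym′ (old t) = old (symmetric t)
    sym′ down    = up
    sym′ up      = down

    embed : ∀ {a b vs} → Walk Tr a b vs → Walk Tr′ a b vs
    embed (single a) = single a
    embed (step t w) = step (old t) (embed w)

    walk⊆ : ∀ {a b vs} → a ∈ ys → Walk Tr a b vs → ∀ {v} → v ∈ vs → v ∈ ys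
    walk⊆ a∈ (single _) (here refl) = a∈
    walk⊆ a∈ (step t w) (here refl) = a∈
    walk⊆ a∈ (step t w) (there v∈)  = walk⊆ (inside t) w v∈

    restrict : ∀ {a b vs} → s ∉ vs → Walk Tr′ a b vs → Walk Tr a b vs
    restrict s∉ (single a)        = single a
    restrict s∉ (step (old t) w) = step t (restrict (s∉ ∘ there) w)
    restrict s∉ (step down w)    = contradiction (there (first∈ w)) s∉
    restrict s∉ (step up w)      = contradiction (here refl) s∉

    -- A path through s would have to enter and leave it through h.
    avoids : ∀ {a b vs} → a ≢ s → b ≢ s → Path Tr′ a b vs → s ∉ vs
    avoids a≢s b≢s (single _ , _) (here s≡a) = a≢s (≡.sym s≡a)
    avoids a≢s b≢s (step _ _ , _) (here s≡a) = a≢s (≡.sym s≡a)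
    avoids a≢s b≢s (step (old t) w , _ ∷ u) (there s∈) =
      avoids (λ { refl → s∉ys (inside t) }) b≢s (w , u) s∈
    avoids a≢s b≢s (step up _ , _) _ = a≢s refl
    avoids a≢s b≢s (step down (single _) , _) _ = b≢s refl
    avoids a≢s b≢s (step down (step (old t) _) , _) _ = s∉ys (inside (symmetric t))
    avoids a≢s b≢s (step down (step up w) , h∉ ∷ _) _ = All.lookup h∉ (there (first∈ w)) refl
    avoids a≢s b≢s (step down (step down _) , _) _ = a≢s refl

    inner : ∀ {a b vs} → a ≢ s → b ≢ s → Path Tr′ a b vs → Path Tr a b vs
    inner a≢s b≢s p@(w , u) = restrict (avoids a≢s b≢s p) w , u

    fromLeaf : ∀ {b vs} → b ≢ s → Path Tr′ s b vs → ∃ λ ws → vs ≡ s ∷ ws × Path Tr h b ws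
    fromLeaf b≢s (single _ , _)       = contradiction refl b≢s
    fromLeaf b≢s (step (old t) w , _) = contradiction (inside (symmetric t)) s∉ys
    fromLeaf b≢s (step down _ , _)    = contradiction h∈ys s∉ys
    fromLeaf b≢s (step up w , s≢ ∷ u) =
      _ , refl , restrict (λ s∈ → All.lookup s≢ s∈ refl) w , u

    loop : ∀ {a vs} → Path Tr′ a a vs → vs ≡ [ a ]
    loop (single _ , _)   = refl
    loop (step _ w , a≢ ∷ _) = contradiction refl (All.lookup a≢ (last∈ w))

    unique-leaf : ∀ {b vs ws} → Path Tr′ s b vs → Path Tr′ s b ws → vs ≡ ws
    unique-leaf {b} p q with b ≟ s
    ... | yes refl = ≡.trans (loop p) (≡.sym (loop q))
    ... | no b≢s with fromLeaf b≢s p | fromLeaf b≢s q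
    ...   | _ , refl , p′ | _ , refl , q′ = cong (s ∷_) (unique p′ q′)

    unique′ : ∀ {a b vs ws} → Path Tr′ a b vs → Path Tr′ a b ws → vs ≡ ws
    unique′ {a} {b} p q with a ≟ s | b ≟ s
    ... | yes refl | _ = unique-leaf p q
    ... | no _ | yes refl = reverse-injective (unique-leaf (path-reverse sym′ p) (path-reverse sym′ q))
    ... | no a≢s | no b≢s = unique (inner a≢s b≢s p) (inner a≢s b≢s q)

    end∈ : ∀ {b ws} → Walk Tr h b ws → b ∈ ys
    end∈ w = walk⊆ h∈ys w (last∈ w)

    running-leaf : ∀ {b vs} → Path Tr′ s b vs → ∀ {e x} → e ∈ vs → E s x → E b x → E e x
    running-leaf {b} p e∈ Es Eb with b ≟ s
    running-leaf p e∈ Es Eb | yes refl with loop p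
    running-leaf p (here refl) Es Eb | yes refl | refl = Es
    running-leaf p e∈ Es Eb | no b≢s with fromLeaf b≢s p
    running-leaf p (here refl) Es Eb | no b≢s | _ , refl , q = Es
    running-leaf p (there e∈) Es Eb  | no b≢s | _ , refl , q =
      -- The ear condition moves the shared vertex from `s` to `h`, where the path in the old tree
      -- begins.
      running q e∈ (ear (end∈ (proj₁ q)) Es Eb) Eb

    running′ : ∀ {a b vs} → Path Tr′ a b vs → ∀ {e x} → e ∈ vs → E a x → E b x → E e x
    running′ {a} {b} {vs} p e∈ Ea Eb with a ≟ s | b ≟ s
    ... | yes refl | _        = running-leaf p e∈ Ea Eb
    ... | no _     | yes refl =
      running-leaf (path-reverse sym′ p) (∈-resp-↭ (↭-sym (↭-reverse vs)) e∈) Eb Ea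
    ... | no a≢s   | no b≢s   = running (inner a≢s b≢s p) e∈ Ea Eb

    leafTo : ∀ {b} → b ∈ ys → ∃ λ vs → Path Tr′ s b vs
    leafTo b∈ with connected h∈ys b∈
    ... | vs , w , u = s ∷ vs , step up (embed w) ,
      All.tabulate (λ v∈ s≡v → s∉ys (subst (_∈ ys) (≡.sym s≡v) (walk⊆ h∈ys w v∈))) ∷ u

    connected′ : ∀ {a b} → a ∈ s ∷ ys → b ∈ s ∷ ys → ∃ λ vs → Path Tr′ a b vs
    connected′ (here refl) (here refl) = _ , single s , [] ∷ []
    connected′ (here refl) (there b∈)  = leafTo b∈
    connected′ (there a∈) (here refl)  = _ , path-reverse sym′ (proj₂ (leafTo a∈))
    connected′ (there a∈) (there b∈) with connected a∈ b∈
    ... | vs , w , u = vs , embed w , u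

  joinTreeOn : DecidableEquality I → ∀ {r ys} → Join E r ys → JoinTreeOn ys
  joinTreeOn _≟_ root = record
    { Tr = λ _ _ → ⊥ ; inside = λ () ; symmetric = λ ()
    ; connected = λ { (here refl) (here refl) → _ , single _ , [] ∷ [] }
    ; unique = λ { (single _ , _) (single _ , _) → refl }
    ; running = λ { (single _ , _) (here refl) Ea _ → Ea } }
  joinTreeOn _≟_ (attach j s∉ h∈ ear) = addLeaf _≟_ s∉ h∈ ear (joinTreeOn _≟_ j)

  αAcyclic-empty : ¬ I → αAcyclicHyp E
  αAcyclic-empty ¬i = (λ _ _ → ⊥) , ((λ _ _ ()) , (λ a → contradiction a ¬i) , λ a → contradiction a ¬i)
                      , λ a → contradiction a ¬i

  αAcyclic-join : DecidableEquality I → ∀ {r ys} → (∀ i → i ∈ ys) → Join E r ys → αAcyclicHyp E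
  αAcyclic-join _≟_ all∈ j = Tr
    , ((λ _ _ → symmetric) , (λ a b → connected (all∈ a) (all∈ b)) , λ _ _ _ _ → unique)
    , λ _ _ _ p _ e∈ _ → running p e∈
    where open JoinTreeOn (joinTreeOn _≟_ j)

-- Chordless paths and induced cycles

module _ {X : Set} (Adj : X → X → Set) (End : X → Set) where

  -- These are induced paths that meet `End` in their last vertex only. That `x` differs from its
  -- successor `y` is left to irreflexivity of `Adj`.
  data Chordless : List X → Set where
    last : ∀ {x} → End x → Chordless (x ∷ [])
    _◂_ : ∀ {x y ys} → ¬ End x × Adj x y × All (λ w → x ≢ w × ¬ Adj x w) ys →
          Chordless (y ∷ ys) → Chordless (x ∷ y ∷ ys)

module _ {X : Set} {Adj : X → X → Set} {End Z : X → Set} where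

  -- Cutting at the last member with `P` leaves a remainder free of `P`. This serves to remove
  -- chords and, later, to choose where the cycle starts.
  cut : {P : X → Set} → U.Decidable P → ∀ {ys} → Any P ys → Chordless Adj End ys → All Z ys →
        ∃₂ λ y zs → P y × All (¬_ ∘ P) zs × Chordless Adj End (y ∷ zs) × All Z (y ∷ zs)
  cut P? (here p) c@(last _) zs = _ , _ , p , [] , c , zs
  cut P? {_ ∷ ys} p c@(_ ◂ c′) zs with Any.any? P? ys
  ... | yes p′ = cut P? p′ c′ (All.tail zs)
  cut P? (here p) c@(_ ◂ c′) zs | no ¬p′ = _ , _ , p , All.¬Any⇒All¬ _ ¬p′ , c , zs
  cut P? (there p) c@(_ ◂ c′) zs | no ¬p′ = contradiction p ¬p′

  -- The walk is processed from its far end: the path found so far is cut at its last vertex equal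
  -- or adjacent to `x`, so no chord at `x` remains.
  shortest : DecidableEquality X → B.Decidable Adj → U.Decidable End → ∀ {x y} → Z x →
             Star (λ p q → Adj p q × Z q) x y → End y →
             ∃ λ ys → Chordless Adj End (x ∷ ys) × All Z (x ∷ ys)
  shortest _≟_ adj? end? Zx ε Ey = [] , last Ey , Zx ∷ []
  shortest _≟_ adj? end? {x} Zx ((a , Zz) ◅ s) Ey with shortest _≟_ adj? end? Zz s Ey | end? x
  ... | _            | yes Ex = [] , last Ex , Zx ∷ []
  ... | ys , c , Zs | no ¬Ex
    with cut (λ w → (x ≟ w) ⊎-dec adj? x w) (here (inj₂ a)) c Zs
  ...   | _ , zs , inj₁ refl , _ , c′ , Zs′ = zs , c′ , Zs′
  ...   | w , zs , inj₂ a′ , ¬zs , c′ , Zs′ =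
    w ∷ zs , (¬Ex , a′ , All.map (λ ¬p → ¬p ∘ inj₁ , ¬p ∘ inj₂) ¬zs) ◂ c′ , Zx ∷ Zs′

Consecutive : {m : ℕ} → Fin m → Fin m → Set
Consecutive i j = suc (toℕ i) ≡ toℕ j ⊎ suc (toℕ j) ≡ toℕ i

module _ {X : Set} {Adj : X → X → Set} {End : X → Set}
         (adj-sym : Symmetric Adj) (adj-irrefl : ∀ {x} → ¬ Adj x x) where

  chordless-adj : ∀ {ys} → Chordless Adj End ys → ∀ i j →
                  Adj (lookup ys i) (lookup ys j) ⇔ Consecutive i j
  chordless-adj {_ ∷ _} c zero zero = mk⇔ (λ a → contradiction a adj-irrefl) λ { (inj₁ ()) ; (inj₂ ()) }
  chordless-adj ((_ , a , _) ◂ _) zero (suc zero) = mk⇔ (λ _ → inj₁ refl) (λ _ → a)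
  chordless-adj ((_ , _ , far) ◂ _) zero (suc (suc j)) =
    mk⇔ (λ a → contradiction a (proj₂ (All.lookup far (∈-lookup j)))) λ { (inj₁ ()) ; (inj₂ ()) }
  chordless-adj ((_ , a , _) ◂ _) (suc zero) zero = mk⇔ (λ _ → inj₂ refl) (λ _ → adj-sym a)
  chordless-adj ((_ , _ , far) ◂ _) (suc (suc i)) zero =
    mk⇔ (λ a → contradiction (adj-sym a) (proj₂ (All.lookup far (∈-lookup i))))
        λ { (inj₁ ()) ; (inj₂ ()) }
  chordless-adj (_ ◂ c) (suc i) (suc j) = mk⇔
    (λ a → Sum.map (cong suc) (cong suc) (to a))
    (λ k → from (Sum.map ℕ.suc-injective ℕ.suc-injective k))
    where open Equivalence (chordless-adj c i j)

  chordless-end : ∀ {ys} → Chordless Adj End ys → ∀ i → End (lookup ys i) ⇔ suc (toℕ i) ≡ length ys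
  chordless-end (last e) zero         = mk⇔ (λ _ → refl) (λ _ → e)
  chordless-end ((¬e , _) ◂ _) zero   = mk⇔ (λ e → contradiction e ¬e) λ ()
  chordless-end (_ ◂ c) (suc i)       = mk⇔ (cong suc ∘ to) (from ∘ ℕ.suc-injective)
    where open Equivalence (chordless-end c i)

  chordless-injective : ∀ {ys} → Chordless Adj End ys → Injective _≡_ _≡_ (lookup ys)
  chordless-injective {_ ∷ _} c {zero} {zero} _ = refl
  chordless-injective ((_ , a , _) ◂ _) {zero} {suc zero} eq =
    contradiction (subst (Adj _) (≡.sym eq) a) adj-irrefl
  chordless-injective ((_ , _ , far) ◂ _) {zero} {suc (suc j)} eq =
    contradiction eq (proj₁ (All.lookup far (∈-lookup j)))
  chordless-injective ((_ , a , _) ◂ _) {suc zero} {zero} eq =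
    contradiction (subst (Adj _) eq a) adj-irrefl
  chordless-injective ((_ , _ , far) ◂ _) {suc (suc i)} {zero} eq =
    contradiction (≡.sym eq) (proj₁ (All.lookup far (∈-lookup i)))
  chordless-injective (_ ◂ c) {suc i} {suc j} eq = cong suc (chordless-injective c eq)

module _ (H : Graph n) where

  Adjacent : Fin n → Fin n → Set
  Adjacent u v = T (adj H u v)

  adjacent? : B.Decidable Adjacent
  adjacent? u v = T? (adj H u v)

  adjacent-sym : Symmetric Adjacent
  adjacent-sym {u} {v} = subst T (sym H u v)

  adjacent-irrefl : ∀ {u} → ¬ Adjacent u u
  adjacent-irrefl {u} = subst T (irref H u)

  -- The hypotheses leave the first and the last vertex of the path as the only neighbours of `a` on
  -- it. With `a` at position 0, the edge to the last vertex is the closing edge of `CycAdj`.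
  close-cycle : ∀ {End : Fin n → Set} {a y ys} → Chordless Adjacent End (y ∷ ys) →
                All (a ≢_) (y ∷ ys) → Adjacent a y →
                (∀ {z} → z ∈ y ∷ ys → End z → Adjacent a z) →
                (∀ {z} → z ∈ ys → Adjacent a z → End z) →
                HasInducedCycle H (suc (suc (length ys)))
  close-cycle {End} {a} {y} {ys} c a≢ ay end⇒adj adj⇒end = vertex , vertex-injective , cyc
    where
    vertex : Fin (suc (suc (length ys))) → Fin n
    vertex = lookup (a ∷ y ∷ ys)

    vertex-injective : Injective _≡_ _≡_ vertex
    vertex-injective {zero}  {zero}  _  = refl
    vertex-injective {zero}  {suc j} eq = contradiction eq (All.lookup a≢ (∈-lookup j))
    vertex-injective {suc i} {zero}  eq = contradiction (≡.sym eq) (All.lookup a≢ (∈-lookup i))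
    vertex-injective {suc i} {suc j} eq =
      cong suc (chordless-injective adjacent-sym adjacent-irrefl c eq)

    apex : ∀ j → Adjacent a (lookup (y ∷ ys) j) ⇔ (toℕ j ≡ 0 ⊎ suc (toℕ j) ≡ suc (length ys))
    apex zero = mk⇔ (λ _ → inj₁ refl) (λ _ → ay)
    apex (suc j) = mk⇔ (inj₂ ∘ to ∘ adj⇒end (∈-lookup j))
      λ { (inj₁ ()) ; (inj₂ eq) → end⇒adj (∈-lookup (suc j)) (from eq) }
      where open Equivalence (chordless-end adjacent-sym adjacent-irrefl c (suc j))

    cyc : ∀ i j → T (adj H (vertex i) (vertex j)) ⇔ CycAdj _ i j
    cyc zero zero = mk⇔ (λ a → contradiction a adjacent-irrefl)
      λ { (inj₁ ()) ; (inj₂ (inj₁ ())) ; (inj₂ (inj₂ (inj₁ ()))) ; (inj₂ (inj₂ (inj₂ ()))) }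
    cyc zero (suc j) = mk⇔
      (λ a → [ (λ j≡0 → inj₁ (cong suc (≡.sym j≡0)))
             , (λ j≡l → inj₂ (inj₂ (inj₂ (cong suc j≡l , refl)))) ]′ (to a))
      λ { (inj₁ eq) → from (inj₁ (≡.sym (ℕ.suc-injective eq)))
        ; (inj₂ (inj₁ ())) ; (inj₂ (inj₂ (inj₁ (() , _))))
        ; (inj₂ (inj₂ (inj₂ (eq , _)))) → from (inj₂ (ℕ.suc-injective eq)) }
      where open Equivalence (apex j)
    cyc (suc i) zero = mk⇔
      (λ a → [ (λ j≡0 → inj₂ (inj₁ (cong suc (≡.sym j≡0))))
             , (λ j≡l → inj₂ (inj₂ (inj₁ (cong suc j≡l , refl)))) ]′ (to (adjacent-sym a)))
      λ { (inj₁ ()) ; (inj₂ (inj₁ eq)) → adjacent-sym (from (inj₁ (≡.sym (ℕ.suc-injective eq))))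
        ; (inj₂ (inj₂ (inj₁ (eq , _)))) → adjacent-sym (from (inj₂ (ℕ.suc-injective eq)))
        ; (inj₂ (inj₂ (inj₂ (() , _)))) }
      where open Equivalence (apex i)
    cyc (suc i) (suc j) = mk⇔
      (λ a → [ (λ eq → inj₁ (cong suc eq)) , (λ eq → inj₂ (inj₁ (cong suc eq))) ]′ (to a))
      λ { (inj₁ eq) → from (inj₁ (ℕ.suc-injective eq))
        ; (inj₂ (inj₁ eq)) → from (inj₂ (ℕ.suc-injective eq))
        ; (inj₂ (inj₂ (inj₁ (_ , ())))) ; (inj₂ (inj₂ (inj₂ (_ , ())))) }
      where open Equivalence (chordless-adj adjacent-sym adjacent-irrefl c i j)

-- Obstructions give long induced cycles

module _ {H : Graph n} {o : Fin n → Fin n → Bool} (orientation : IsOrientation H o) where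

  arc⇒adjacent : ∀ {u v} → Arc o u v → Adjacent H u v
  arc⇒adjacent {u} {v} a = subst T (≡.sym (proj₁ orientation u v)) (Equivalence.from T-∨ (inj₁ a))

  adjacent⇒arc : ∀ {u v} → Adjacent H u v → Arc o u v ⊎ Arc o v u
  adjacent⇒arc {u} {v} a = Equivalence.to T-∨ (subst T (proj₁ orientation u v) a)

  reach? : B.Decidable (Reach o)
  reach? = star? (λ u v → T? (o u v))

  module _ (acyclic : IsAcyclicDir o) where

    Lowest : Fin n → Fin n → Fin n → Set
    Lowest e u v = ∃ λ a → Reach o e a × Reach o a u × Reach o a v
                         × (∀ {z} → Arc o a z → Avoid (Reach o) u v z)

    -- The search descends to a child above both `u` and `v` while there is one. By acyclicity a
    -- child does not reach its parent, so the reachable set shrinks, and `m` bounds its size.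
    lowest : ∀ {u v} m e → ∣ reach? e ∣ ≤ m → Reach o e u → Reach o e v → Lowest e u v
    lowest {u} {v} m e e≤m eu ev with Fin.any? (λ z → T? (o e z) ×-dec reach? z u ×-dec reach? z v)
    ... | no ¬z = e , ε , eu , ev , λ ez both → ¬z (_ , ez , both)
    ... | yes (z , ez , zu , zv) = descend m e≤m
      where
      fewer : ∣ reach? z ∣ < ∣ reach? e ∣
      fewer = ∣∣-strict (reach? z) (reach? e) (λ s → ez ◅ s) e ε (acyclic e z ez)

      descend : ∀ m → ∣ reach? e ∣ ≤ m → Lowest e u v
      descend zero e≤m = contradiction (ℕ.<-≤-trans fewer e≤m) λ ()
      descend (suc m) e≤m with lowest m z (ℕ.≤-pred (ℕ.<-≤-trans fewer e≤m)) zu zv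
      ... | a , za , rest = a , ez ◅ za , rest

  module _ (noCycle : ∀ k → 6 ≤ k → ¬ HasInducedCycle H k)
           {a u v : Fin n} (low : ∀ {z} → Arc o a z → Avoid (Reach o) u v z) where

    -- The part of the graph in which a cycle through a is closed up: a is adjacent there only to
    -- vertices that lie between a and exactly one of u and v.
    Zone : Fin n → Set
    Zone z = Avoid (Reach o) u v z × (Reach o a z → Reach o z u ⊎ Reach o z v)

    Start End : Fin n → Set
    Start z = Adjacent H a z × Reach o z u
    End z   = Adjacent H a z × Reach o z v

    start? : U.Decidable Start
    start? z = adjacent? H a z ×-dec reach? z u

    end? : U.Decidable End
    end? z = adjacent? H a z ×-dec reach? z v

    ZoneStep : Fin n → Fin n → Set
    ZoneStep p q = Adjacent H p q × Zone p × Zone q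

    zoneStep-sym : Symmetric ZoneStep
    zoneStep-sym (a , Zp , Zq) = adjacent-sym H a , Zq , Zp

    descend : ∀ {p q} → (∀ {z} → Reach o p z → Reach o z q → Zone z) → Reach o p q → Star ZoneStep p q
    descend zone ε = ε
    descend zone (t ◅ s) = (arc⇒adjacent t , zone ε (t ◅ s) , zone (t ◅ ε) s)
                           ◅ descend (λ pz zq → zone (t ◅ pz) zq) s

    ascend : ∀ {p q} → (∀ {z} → Reach o p z → Reach o z q → Zone z) → Reach o p q → Star ZoneStep q p
    ascend zone s = Star.reverse zoneStep-sym (descend zone s)

    avoid-below : ∀ {p z} → Avoid (Reach o) u v p → Reach o p z → Avoid (Reach o) u v z
    avoid-below avoid pz (zu , zv) = avoid (pz ◅◅ zu , pz ◅◅ zv)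

    -- A link is a shared vertex `x` that `a` does not reach. Going down to `x` and up to the next
    -- hyperedge meets only vertices that reach `x`; `a` reaches none of them, so the second clause
    -- of `Zone` is vacuous.
    along : ∀ {f g} → Avoid (Reach o) u v f →
            Star (λ p q → Linked (Reach o) a p q × Avoid (Reach o) u v q) f g →
            Star ZoneStep f g × Avoid (Reach o) u v g
    along af ε = ε , af
    along af (((x , fx , hx , ¬ax) , ah) ◅ s) with along ah s
    ... | walk , ag = (descend (zone af) fx ◅◅ ascend (zone ah) hx ◅◅ walk) , ag
      where
      zone : ∀ {p z} → Avoid (Reach o) u v p → Reach o p z → Reach o z x → Zone z
      zone ap pz zx = avoid-below ap pz , λ az → contradiction (az ◅◅ zx) ¬ax

    zone-adjacent : ∀ {z} → Reach o a u → Reach o a v → Zone z → Adjacent H a z → Start z ⊎ End z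
    zone-adjacent au av (avoid , between) adj with adjacent⇒arc adj
    ... | inj₁ az = Sum.map (adj ,_) (adj ,_) (between (az ◅ ε))
    ... | inj₂ za = contradiction (za ◅ au , za ◅ av) avoid

    -- The tail of the arc between `y` and `z` would reach both `u` and `v`.
    separated : ∀ {y z} → Zone y → Zone z → Adjacent H y z → Reach o y u → ¬ Reach o z v
    separated (ay , _) (az , _) adj yu zv with adjacent⇒arc adj
    ... | inj₁ yz = ay (yu , yz ◅ zv)
    ... | inj₂ zy = az (zy ◅ yu , zv)

    -- The edge at `a` must point from `a` to `z`. If also `z → w`, then `a` reaches `w`, so `w` is
    -- above `u` or `v`, and above the same one as `z`, which is not above both.
    below-a : Reach o a u → Reach o a v → ∀ {z w} → Zone z → Adjacent H a z → Zone w → Adjacent H z w →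
              (Reach o z u → Reach o w u) × (Reach o z v → Reach o w v)
    below-a au av {z} {w} Zz@(avz , _) az Zw zw with adjacent⇒arc zw | adjacent⇒arc az
    ... | _       | inj₂ z→a = contradiction (z→a ◅ au , z→a ◅ av) avz
    ... | inj₂ wz | _ = (wz ◅_) , (wz ◅_)
    ... | inj₁ z→w | inj₁ a→z with proj₂ Zw (a→z ◅ z→w ◅ ε)
    ...   | inj₁ wu = (λ _ → wu) , λ zv → contradiction (z→w ◅ wu , zv) avz
    ...   | inj₂ wv = (λ zu → contradiction (zu , z→w ◅ wv) avz) , λ _ → wv

    -- The first vertex is above `u` and, by `below-a`, so is the second; likewise the last two are
    -- above `v`. By `separated` no edge leads from a vertex above `u` to one above `v`, which
    -- excludes paths of at most four vertices. With `a` the cycle has at least six.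
    long : Reach o a u → Reach o a v → ∀ {y ys} → Start y →
           Chordless (Adjacent H) End (y ∷ ys) → All Zone (y ∷ ys) → 4 ≤ length ys
    long au av (_ , yu) (last (_ , yv)) ((ay , _) ∷ _) = contradiction (yu , yv) ay
    long au av (_ , yu) ((_ , yz , _) ◂ last (_ , zv)) (Zy ∷ Zz ∷ _) =
      contradiction zv (separated Zy Zz yz yu)
    long au av (ay , yu) ((_ , yz , _) ◂ ((_ , zw , _) ◂ last (_ , wv))) (Zy ∷ Zz ∷ Zw ∷ _) =
      contradiction wv (separated Zz Zw zw (proj₁ (below-a au av Zy ay Zz yz) yu))
    long au av (ay , yu) ((_ , yz , _) ◂ ((_ , zw , _) ◂ ((_ , wt , _) ◂ last (at , tv))))
         (Zy ∷ Zz ∷ Zw ∷ Zt ∷ _) =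
      contradiction (proj₂ (below-a au av Zt at Zw (adjacent-sym H wt)) tv)
        (separated Zz Zw zw (proj₁ (below-a au av Zy ay Zz yz) yu))
    long au av _ (_ ◂ (_ ◂ (_ ◂ (_ ◂ _)))) _ = s≤s (s≤s (s≤s (s≤s z≤n)))

    not-below : ∀ {f g} → Avoid (Reach o) u v f → Reach o a u → Reach o a v →
                Reach o f u → Reach o g v → ¬ Star (λ p q → Linked (Reach o) a p q × Avoid (Reach o) u v q) f g
    -- If `a` is `u` or `v` itself, then `f` or `g` respectively reaches both.
    not-below af ε av fu gv s = af (fu , fu ◅◅ av)
    not-below af au@(_ ◅ _) ε fu gv s = proj₂ (along af s) (gv ◅◅ au , gv)
    not-below {f} {g} af au@(_◅_ {j = p} ap pu) av@(_◅_ {j = q} aq qv) fu gv s with along af s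
    ... | f~g , ag = contradict (shortest Fin._≟_ (adjacent? H) end? (u-zone (low ap) ε pu)
                                (Star.map (λ { (adj , _ , Zq) → adj , Zq }) p~q) (arc⇒adjacent aq , qv))
      where
      u-zone : ∀ {p z} → Avoid (Reach o) u v p → Reach o p z → Reach o z u → Zone z
      u-zone ap pz zu = avoid-below ap pz , λ _ → inj₁ zu

      v-zone : ∀ {p z} → Avoid (Reach o) u v p → Reach o p z → Reach o z v → Zone z
      v-zone ap pz zv = avoid-below ap pz , λ _ → inj₂ zv

      p~q : Star ZoneStep p q
      -- From the child `p` of `a` the route runs down to `u`, up to `f`, along the chain to `g`,
      -- down to `v` and up to the child `q`.
      p~q = descend (u-zone (low ap)) pu ◅◅ ascend (u-zone af) fu ◅◅ f~g
            ◅◅ descend (v-zone ag) gv ◅◅ ascend (v-zone (low aq)) qv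

      contradict : (∃ λ ys → Chordless (Adjacent H) End (p ∷ ys) × All Zone (p ∷ ys)) → ⊥
      -- After the last `Start` vertex, any further neighbour of `a` on the path lies in `End`,
      -- hence is the last vertex.
      contradict (ys , c , Zs) with cut start? (here (arc⇒adjacent ap , pu)) c Zs
      ... | y , zs , Sy@(ay , _) , ¬Szs , c′ , Zs′ =
        noCycle _ (s≤s (s≤s (long au av Sy c′ Zs′)))
          (close-cycle H c′ (All.map (λ { (avoid , _) refl → avoid (au , av) }) Zs′) ay
            (λ _ → proj₁)
            (λ z∈ az → [ (λ Sz → contradiction Sz (All.lookup ¬Szs z∈)) , id ]′
                         (zone-adjacent au av (All.lookup Zs′ (there z∈)) az)))

  unobstructed : IsAcyclicDir o → (∀ k → 6 ≤ k → ¬ HasInducedCycle H k) → Unobstructed (Reach o)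
  unobstructed acyclic noCycle {e} eu ev fu gv af s with lowest acyclic _ e ℕ.≤-refl eu ev
  -- What `e` does not reach, `a` does not reach either, so every link outside `e` is a link outside
  -- `a`.
  ... | a , ea , au , av , low = not-below noCycle low af au av fu gv
    (Star.map (λ { ((x , fx , gx , ¬ex) , ag) → (x , fx , gx , λ ax → ¬ex (ea ◅◅ ax)) , ag }) s)

-- Sources

source-≡ : {o : Fin n → Fin n → Bool} {s t : Source o} → proj₁ s ≡ proj₁ t → s ≡ t
source-≡ {s = u , _} {t = _ , _} refl = cong (u ,_) (T-irrelevant _ _)

_≟ˢ_ : {o : Fin n → Fin n → Bool} → DecidableEquality (Source o)
s ≟ˢ t with proj₁ s Fin.≟ proj₁ t
... | yes eq = yes (source-≡ eq)
... | no neq = no λ eq → neq (cong proj₁ eq)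

module _ (o : Fin n → Fin n → Bool) where

  sourceAt : Fin n → List (Source o)
  sourceAt u with T? ⌊ isSource? o u ⌋
  ... | yes t = [ u , t ]
  ... | no  _ = []

  sources : List (Source o)
  sources = deduplicate _≟ˢ_ (concatMap sourceAt (allFin n))

  sources-unique : Unique sources
  sources-unique = Unique.deduplicate-! _≟ˢ_ (concatMap sourceAt (allFin n))

  ∈-sources : ∀ s → s ∈ sources
  ∈-sources s@(u , t) = ∈-deduplicate⁺ _≟ˢ_
    (∈-concatMap⁺ sourceAt (Any.map (λ { refl → at }) (∈-allFin u)))
    where
    at : s ∈ sourceAt u
    at with T? ⌊ isSource? o u ⌋
    ... | yes _ = here (source-≡ refl)
    ... | no ¬t = contradiction t ¬t

root-source : {o : Fin n → Fin n → Bool} → ∀ {r s} → IsSource o s → Reach o r s → r ≡ s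
root-source src ε = refl
root-source src (t ◅ p) with root-source src p
... | refl = contradiction (subst T (src _) t) id

-- Cycles in trees

module _ {I : Set} {Tr : I → I → Set} (tree : IsTree Tr) where

  no-triangle : ∀ {a b c} → a ≢ b → b ≢ c → a ≢ c → Tr a b → Tr b c → ¬ Tr a c
  no-triangle {a} {b} {c} a≢b b≢c a≢c ab bc ac
    with proj₂ (proj₂ tree) a c _ _
           (step ab (step bc (single c)) , (a≢b ∷ a≢c ∷ []) ∷ (b≢c ∷ []) ∷ [] ∷ [])
           (step ac (single c) , (a≢c ∷ []) ∷ [] ∷ [])
  ... | ()

  -- The second node on the tree path from `a` to `b` contains `x` and differs from `a`, so it is
  -- `b`.
  tree-edge : {V : Set} {E : I → V → Set} →
              (∀ e₁ e₂ vs → Path Tr e₁ e₂ vs → ∀ e → e ∈ vs → ∀ x → E e₁ x → E e₂ x → E e x) →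
              ∀ {a b x} → a ≢ b → E a x → E b x → (∀ {e} → E e x → e ≡ a ⊎ e ≡ b) → Tr a b
  tree-edge running {a} {b} {x} a≢b Ea Eb only with proj₁ (proj₂ tree) a b
  ... | _ , single _ , _ = contradiction refl a≢b
  ... | vs , step {b = c} t w , a≢ ∷ u
    with only (running a b vs (step t w , a≢ ∷ u) c (there (first∈ w)) x Ea Eb)
  ...   | inj₁ refl = contradiction refl (All.lookup a≢ (first∈ w))
  ...   | inj₂ refl = t

-- Orienting a graph by weights

module ByWeight (H : Graph n) (weight : Fin n → ℕ) where

  -- This packs the lexicographic order by weight and then index into one number: `toℕ v` is below
  -- `n`, so it only breaks ties.
  key : Fin n → ℕ
  key v = weight v * n + toℕ v

  key-mono : ∀ {u v} → weight u < weight v → key u < key v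
  key-mono {u} {v} wu<wv = begin-strict
    weight u * n + toℕ u <⟨ ℕ.+-monoʳ-< (weight u * n) (Fin.toℕ<n u) ⟩
    weight u * n + n     ≡⟨ ℕ.+-comm (weight u * n) n ⟩
    suc (weight u) * n   ≤⟨ ℕ.*-monoˡ-≤ n wu<wv ⟩
    weight v * n         ≤⟨ ℕ.m≤m+n _ _ ⟩
    key v                ∎
    where open ℕ.≤-Reasoning

  key-injective : ∀ {u v} → key u ≡ key v → u ≡ v
  key-injective {u} {v} eq with ℕ.<-cmp (weight u) (weight v)
  ... | tri< lt _ _ = contradiction eq (ℕ.<⇒≢ (key-mono lt))
  ... | tri> _ _ gt = contradiction (≡.sym eq) (ℕ.<⇒≢ (key-mono gt))
  ... | tri≈ _ same _ = Fin.toℕ-injective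
    (ℕ.+-cancelˡ-≡ (weight u * n) _ _ (≡.trans eq (cong (λ w → w * n + toℕ v) (≡.sym same))))

  orient : Fin n → Fin n → Bool
  orient u v = adj H u v ∧ (key u <ᵇ key v)

  arc⇒key : ∀ {u v} → Arc orient u v → key u < key v
  arc⇒key a = ℕ.<ᵇ⇒< _ _ (proj₂ (Equivalence.to T-∧ a))

  arc⇒adj : ∀ {u v} → Arc orient u v → Adjacent H u v
  arc⇒adj a = proj₁ (Equivalence.to T-∧ a)

  arc⇒weight : ∀ {u v} → Arc orient u v → weight u ≤ weight v
  arc⇒weight a = ℕ.≮⇒≥ λ gt → ℕ.<-asym (arc⇒key a) (key-mono gt)

  weight⇒arc : ∀ {u v} → Adjacent H u v → weight u < weight v → Arc orient u v
  weight⇒arc a lt = Equivalence.from T-∧ (a , ℕ.<⇒<ᵇ (key-mono lt))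

  orient-isOrientation : IsOrientation H orient
  orient-isOrientation = covers , λ u v uv → ¬-not λ vu →
    ℕ.<-asym (arc⇒key (Equivalence.from T-≡ uv)) (arc⇒key (Equivalence.from T-≡ vu))
    where
    compare : ∀ {u v} → u ≢ v → (key u <ᵇ key v) ∨ (key v <ᵇ key u) ≡ true
    compare {u} {v} u≢v with ℕ.<-cmp (key u) (key v)
    ... | tri< lt _ _ = Equivalence.to T-≡ (Equivalence.from T-∨ (inj₁ (ℕ.<⇒<ᵇ lt)))
    ... | tri≈ _ eq _ = contradiction (key-injective eq) u≢v
    ... | tri> _ _ gt = Equivalence.to T-≡ (Equivalence.from T-∨ (inj₂ (ℕ.<⇒<ᵇ gt)))

    covers : ∀ u v → adj H u v ≡ orient u v ∨ orient v u
    covers u v rewrite sym H v u with adj H u v in eq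
    ... | false = refl
    ... | true  = ≡.sym (compare λ { refl → case ≡.trans (≡.sym eq) (irref H u) of λ () })

  orient-acyclic : IsAcyclicDir orient
  orient-acyclic u v a s = ℕ.<⇒≱ (arc⇒key a) (reach⇒key s)
    where
    reach⇒key : ∀ {u v} → Reach orient u v → key u ≤ key v
    reach⇒key ε       = ℕ.≤-refl
    reach⇒key (t ◅ s) = ℕ.≤-trans (ℕ.<⇒≤ (arc⇒key t)) (reach⇒key s)

-- Graphs without long induced cycles

noLongHole⇒αAcyclic : (H : Graph n) → (∀ k → 6 ≤ k → ¬ HasInducedCycle H k) → αAcyclicGraph H
noLongHole⇒αAcyclic H noCycle o orientation acyclic =
  fromList (sources o) (sources-unique o) (∈-sources o)
  where
  E : Source o → Fin _ → Set
  E s = Reach o (proj₁ s)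

  E-unobstructed : Unobstructed E
  E-unobstructed eu ev fu gv avoid s =
    -- Here every vertex counts as a hyperedge; a chain of sources is in particular a chain of
    -- vertices.
    unobstructed {H = H} orientation acyclic noCycle eu ev fu gv avoid (Star.gmap proj₁ id s)

  fromList : ∀ S → Unique S → (∀ s → s ∈ S) → αAcyclicDir o
  fromList [] _ all∈ = αAcyclic-empty E λ s → case all∈ s of λ ()
  fromList (e ∷ S) uniq all∈ with
    JoinTree.joinTree {E = E} (λ s → reach? {H = H} orientation (proj₁ s))
      (λ {e} {u} {v} {f} → E-unobstructed {e} {u} {v} {f}) (length S) e S ℕ.≤-refl uniq
  ... | ws , j , _ , ⊆ws = αAcyclic-join E _≟ˢ_ (λ s → ⊆ws (all∈ s)) j

-- A bad orientation from a long induced cycle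

module LongHole (H : Graph n) (k : ℕ) (f : Fin (6 + k) → Fin n) (f-injective : Injective _≡_ _≡_ f)
                (f-adj : ∀ i j → T (adj H (f i) (f j)) ⇔ CycAdj (6 + k) i j) where

  pattern p0 = zero
  pattern p1 = suc zero
  pattern p2 = suc (suc zero)
  pattern p3 = suc (suc (suc zero))
  pattern p4 = suc (suc (suc (suc zero)))
  pattern p5+ j = suc (suc (suc (suc (suc j))))

  -- The cycle gets the sources 0, 2, 4 and the sinks 1, 3, 5; all other vertices come after it.
  rank : Fin (6 + k) → ℕ
  rank p0      = 0
  rank p1      = suc k
  rank p2      = 0
  rank p3      = suc k
  rank p4      = 0
  -- Ranks fall from `k + 1` at position 5 to 1 at position `5 + k`, so this stretch is directed
  -- from position 0 across the closing edge and back down to 5.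
  rank (p5+ j) = suc k ∸ toℕ j

  rank≤ : ∀ i → rank i ≤ suc k
  rank≤ p0      = z≤n
  rank≤ p1      = ℕ.≤-refl
  rank≤ p2      = z≤n
  rank≤ p3      = ℕ.≤-refl
  rank≤ p4      = z≤n
  rank≤ (p5+ j) = ℕ.m∸n≤m (suc k) (toℕ j)

  position? : ∀ v → Dec (∃ λ i → f i ≡ v)
  position? v = Fin.any? λ i → f i Fin.≟ v

  weight : Fin n → ℕ
  weight v with position? v
  ... | yes (i , _) = rank i
  -- This exceeds every rank, so no vertex off the cycle has an arc into the cycle.
  ... | no _        = 2 + k

  weight-f : ∀ i → weight (f i) ≡ rank i
  weight-f i with position? (f i)
  ... | yes (j , fj≡fi) = cong rank (f-injective fj≡fi)
  ... | no ¬i = contradiction (i , refl) ¬i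

  on-cycle : ∀ {v} → weight v ≤ suc k → ∃ λ i → f i ≡ v
  on-cycle {v} w≤ with position? v
  ... | yes p = p
  ... | no _  = contradiction w≤ (ℕ.<⇒≱ ℕ.≤-refl)

  open ByWeight H weight

  arc-between : ∀ {i j} → CycAdj (6 + k) i j → rank i < rank j → Arc orient (f i) (f j)
  arc-between {i} {j} c lt = weight⇒arc (Equivalence.from (f-adj i j) c)
    (≡.subst₂ _<_ (≡.sym (weight-f i)) (≡.sym (weight-f j)) lt)

  arc-into : ∀ {w j} → Arc orient w (f j) → ∃ λ i → f i ≡ w × CycAdj (6 + k) i j × rank i ≤ rank j
  arc-into {w} {j} a
    with on-cycle (ℕ.≤-trans (subst (weight w ≤_) (weight-f j) (arc⇒weight a)) (rank≤ j))
  ... | i , refl = i , refl , Equivalence.to (f-adj i j) (arc⇒adj a)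
                 , ≡.subst₂ _≤_ (weight-f i) (weight-f j) (arc⇒weight a)

  data Low : Fin (6 + k) → Set where
    low0 : Low p0
    low2 : Low p2
    low4 : Low p4

  low : ∀ i → rank i ≤ 0 → Low i
  low p0 _ = low0
  low p2 _ = low2
  low p4 _ = low4
  low (p5+ j) r≤0 = contradiction r≤0 (ℕ.<⇒≱ (ℕ.m<n⇒0<n∸m (Fin.toℕ<n j)))

  rank-low : ∀ {i} → Low i → rank i ≡ 0
  rank-low low0 = refl
  rank-low low2 = refl
  rank-low low4 = refl

  low-apart : ∀ {i j} → Low i → Low j → ¬ CycAdj (6 + k) i j
  low-apart li lj =
    [ consecutive li lj , [ consecutive lj li , [ wrap li ∘ proj₁ , wrap lj ∘ proj₁ ]′ ]′ ]′
    where
    consecutive : ∀ {i j} → Low i → Low j → suc (toℕ i) ≢ toℕ j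
    consecutive low0 low0 ()
    consecutive low0 low2 ()
    consecutive low0 low4 ()
    consecutive low2 low0 ()
    consecutive low2 low2 ()
    consecutive low2 low4 ()
    consecutive low4 low0 ()
    consecutive low4 low2 ()
    consecutive low4 low4 ()

    wrap : ∀ {i} → Low i → suc (toℕ i) ≢ 6 + k
    wrap low0 ()
    wrap low2 ()
    wrap low4 ()

  -- An arc into a low position would come from a position of rank 0, and no two of those are
  -- adjacent on the cycle.
  low-source : ∀ {i} → Low i → IsSource orient (f i)
  low-source {i} li w = ¬-not λ wi → no-arc (arc-into (Equivalence.from T-≡ wi))
    where
    no-arc : ¬ ∃ λ j → f j ≡ w × CycAdj (6 + k) j i × rank j ≤ rank i
    no-arc (j , _ , c , r≤) = low-apart (low j (subst (rank j ≤_) (rank-low li) r≤)) li c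

  -- M is an arc of the cycle between the low positions A and B, and everything in it lies below A.
  module Below {A B} (lowA : Low A) (lowB : Low B) (M : Fin (6 + k) → Set)
               (ends : ∀ {i j} → M j → CycAdj (6 + k) i j → M i ⊎ i ≡ A ⊎ i ≡ B)
               (reached : ∀ {j} → M j → Reach orient (f A) (f j)) where

    -- Traced backwards, a path can leave the image of `M` only into `f A` or `f B`; these are
    -- sources, so the path starts there.
    ancestor : ∀ {s x} → Reach orient s x → ∃ (λ j → M j × f j ≡ x) →
               (∃ λ j → M j × f j ≡ s) ⊎ s ≡ f A ⊎ s ≡ f B
    ancestor ε m = inj₁ m
    ancestor (t ◅ p) m with ancestor p m
    ... | inj₂ (inj₁ refl) = contradiction (subst T (low-source lowA _) t) id
    ... | inj₂ (inj₂ refl) = contradiction (subst T (low-source lowB _) t) id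
    ... | inj₁ (j , Mj , refl) with arc-into t
    ...   | i , refl , c , _ with ends Mj c
    ...     | inj₁ Mi = inj₁ (i , Mi , refl)
    ...     | inj₂ i≡ = inj₂ (Sum.map (cong f) (cong f) i≡)

    source-above : ∀ {s j} → M j → IsSource orient s → Reach orient s (f j) → s ≡ f A ⊎ s ≡ f B
    source-above Mj src p with ancestor p (_ , Mj , refl)
    ... | inj₂ s≡ = s≡
    -- A source inside the stretch is itself reached from `f A`, hence equals it.
    ... | inj₁ (j , Mj′ , refl) = inj₁ (≡.sym (root-source src (reached Mj′)))

  to1 : Reach orient (f p0) (f p1)
  to1 = arc-between (inj₁ refl) (s≤s z≤n) ◅ ε

  from2to1 : Reach orient (f p2) (f p1)
  from2to1 = arc-between (inj₂ (inj₁ refl)) (s≤s z≤n) ◅ ε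

  from2to3 : Reach orient (f p2) (f p3)
  from2to3 = arc-between (inj₁ refl) (s≤s z≤n) ◅ ε

  from4to3 : Reach orient (f p4) (f p3)
  from4to3 = arc-between (inj₂ (inj₁ refl)) (s≤s z≤n) ◅ ε

  from4to5 : Reach orient (f p4) (f (p5+ zero))
  from4to5 = arc-between (inj₁ refl) (s≤s z≤n) ◅ ε

  -- The induction is on the distance `d` to the last position, which position 0 reaches by the
  -- closing edge.
  from0to5+ : ∀ d (j : Fin (suc k)) → toℕ j + d ≡ k → Reach orient (f p0) (f (p5+ j))
  from0to5+ zero j j+0≡k =
    arc-between (inj₂ (inj₂ (inj₂ (cong (6 +_) (≡.trans (≡.sym (ℕ.+-identityʳ _)) j+0≡k) , refl))))
      (ℕ.m<n⇒0<n∸m (Fin.toℕ<n j)) ◅ ε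
  from0to5+ (suc d) j j+d≡k = from0to5+ d j′ (≡.trans (cong (_+ d) j′≡) eq) ◅◅
    arc-between (inj₂ (inj₁ (cong (5 +_) (≡.sym j′≡)))) down ◅ ε
    where
    eq : suc (toℕ j) + d ≡ k
    eq = ≡.trans (≡.sym (ℕ.+-suc (toℕ j) d)) j+d≡k

    j<k : suc (toℕ j) < suc k
    j<k = s≤s (ℕ.≤-trans (ℕ.m≤m+n _ d) (ℕ.≤-reflexive eq))

    j′ : Fin (suc k)
    j′ = fromℕ< j<k

    j′≡ : toℕ j′ ≡ suc (toℕ j)
    j′≡ = Fin.toℕ-fromℕ< j<k

    down : suc k ∸ toℕ j′ < suc k ∸ toℕ j
    down = subst (λ t → suc k ∸ t < suc k ∸ toℕ j) (≡.sym j′≡)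
             (ℕ.∸-monoʳ-< (ℕ.n<1+n (toℕ j)) (ℕ.<⇒≤ j<k))

  data Late : Fin (6 + k) → Set where
    late : ∀ j → Late (p5+ j)

  ends1 : ∀ {i j} → j ≡ p1 → CycAdj (6 + k) i j → i ≡ p1 ⊎ i ≡ p0 ⊎ i ≡ p2
  ends1 {p0} refl c = inj₂ (inj₁ refl)
  ends1 {p1} refl c = inj₁ refl
  ends1 {p2} refl c = inj₂ (inj₂ refl)
  ends1 {suc (suc (suc _))} refl (inj₁ ())
  ends1 {suc (suc (suc _))} refl (inj₂ (inj₁ ()))
  ends1 {suc (suc (suc _))} refl (inj₂ (inj₂ (inj₁ (_ , ()))))
  ends1 {suc (suc (suc _))} refl (inj₂ (inj₂ (inj₂ (() , _))))

  ends3 : ∀ {i j} → j ≡ p3 → CycAdj (6 + k) i j → i ≡ p3 ⊎ i ≡ p2 ⊎ i ≡ p4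
  ends3 {p2} refl c = inj₂ (inj₁ refl)
  ends3 {p3} refl c = inj₁ refl
  ends3 {p4} refl c = inj₂ (inj₂ refl)
  ends3 {p0} refl (inj₁ ())
  ends3 {p0} refl (inj₂ (inj₁ ()))
  ends3 {p0} refl (inj₂ (inj₂ (inj₁ (() , _))))
  ends3 {p0} refl (inj₂ (inj₂ (inj₂ (() , _))))
  ends3 {p1} refl (inj₁ ())
  ends3 {p1} refl (inj₂ (inj₁ ()))
  ends3 {p1} refl (inj₂ (inj₂ (inj₁ (() , _))))
  ends3 {p1} refl (inj₂ (inj₂ (inj₂ (() , _))))
  ends3 {p5+ _} refl (inj₁ ())
  ends3 {p5+ _} refl (inj₂ (inj₁ ()))
  ends3 {p5+ _} refl (inj₂ (inj₂ (inj₁ (_ , ()))))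
  ends3 {p5+ _} refl (inj₂ (inj₂ (inj₂ (() , _))))

  ends5 : ∀ {i j} → Late j → CycAdj (6 + k) i j → Late i ⊎ i ≡ p0 ⊎ i ≡ p4
  ends5 {p0} (late _) c = inj₂ (inj₁ refl)
  ends5 {p4} (late _) c = inj₂ (inj₂ refl)
  ends5 {p5+ i} (late _) c = inj₁ (late i)
  ends5 {p1} (late _) (inj₁ ())
  ends5 {p1} (late _) (inj₂ (inj₁ ()))
  ends5 {p1} (late _) (inj₂ (inj₂ (inj₁ (() , _))))
  ends5 {p1} (late _) (inj₂ (inj₂ (inj₂ (_ , ()))))
  ends5 {p2} (late _) (inj₁ ())
  ends5 {p2} (late _) (inj₂ (inj₁ ()))
  ends5 {p2} (late _) (inj₂ (inj₂ (inj₁ (() , _))))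
  ends5 {p2} (late _) (inj₂ (inj₂ (inj₂ (_ , ()))))
  ends5 {p3} (late _) (inj₁ ())
  ends5 {p3} (late _) (inj₂ (inj₁ ()))
  ends5 {p3} (late _) (inj₂ (inj₂ (inj₁ (() , _))))
  ends5 {p3} (late _) (inj₂ (inj₂ (inj₂ (_ , ()))))

  from0to5 : ∀ {j} → Late j → Reach orient (f p0) (f j)
  from0to5 (late j) = from0to5+ (k ∸ toℕ j) j (ℕ.m+[n∸m]≡n (ℕ.≤-pred (Fin.toℕ<n j)))

  source : ∀ {i} → Low i → Source orient
  source {i} li = f i , fromWitness (low-source li)

  source-≢ : ∀ {i j} (li : Low i) (lj : Low j) → i ≢ j → source li ≢ source lj
  source-≢ li lj i≢j eq = i≢j (f-injective (cong proj₁ eq))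

  source-only : ∀ {i j x} (li : Low i) (lj : Low j) →
                (∀ {s} → IsSource orient s → Reach orient s x → s ≡ f i ⊎ s ≡ f j) →
                ∀ {s : Source orient} → Reach orient (proj₁ s) x → s ≡ source li ⊎ s ≡ source lj
  source-only li lj only {_ , t} p = Sum.map source-≡ source-≡ (only (toWitness t) p)

  not-αAcyclic : ¬ αAcyclicDir orient
  not-αAcyclic (Tr , tree , running) = no-triangle tree 0≢2 2≢4 0≢4
    (tree-edge tree running 0≢2 to1 from2to1
      (source-only low0 low2 (Below.source-above low0 low2 (_≡ p1) ends1 (λ { refl → to1 }) refl)))
    (tree-edge tree running 2≢4 from2to3 from4to3
      (source-only low2 low4 (Below.source-above low2 low4 (_≡ p3) ends3 (λ { refl → from2to3 }) refl)))
    -- `late zero` is position 5, which 4 reaches by one arc and 0 the long way round the cycle.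
    (tree-edge tree running 0≢4 (from0to5 (late zero)) from4to5
      (source-only low0 low4 (Below.source-above low0 low4 Late ends5 from0to5 (late zero))))
    where
    0≢2 : source low0 ≢ source low2
    0≢2 = source-≢ low0 low2 λ ()

    2≢4 : source low2 ≢ source low4
    2≢4 = source-≢ low2 low4 λ ()

    0≢4 : source low0 ≢ source low4
    0≢4 = source-≢ low0 low4 λ ()

αAcyclic⇒noLongHole : (H : Graph n) → αAcyclicGraph H → ∀ k → 6 ≤ k → ¬ HasInducedCycle H k
αAcyclic⇒noLongHole H αH _ (s≤s (s≤s (s≤s (s≤s (s≤s (s≤s (z≤n {k}))))))) (f , f-injective , f-adj) =
  not-αAcyclic (αH orient orient-isOrientation orient-acyclic)
  where
  open LongHole H k f f-injective f-adj
  open ByWeight H weight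

theorem1p7 : ∀ (n : ℕ) (H : Graph n) →
    αAcyclicGraph H ⇔ (∀ (k : ℕ) → 6 ≤ k → ¬ HasInducedCycle H k)
theorem1p7 n H = mk⇔ (αAcyclic⇒noLongHole H) (noLongHole⇒αAcyclic H)
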